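{- Let $G=(V,E)$ be a connected graph, $G'=(V,E')$ a graph with $E\subseteq E'$, and $\theta\in[\tfrac12,1]$. Then the function $\tilde d^\theta_{E'}:\tilde X_{GG'}\times\tilde X_{GG'}\to\mathbb{R}_0^+$ defined by $$\tilde d^\theta_{E'}(\tilde x,\tilde x'):=d^\theta_{E'}(\operatorname{cl}_{GG'}\tilde x,\operatorname{cl}_{GG'}\tilde x')$$ is a pseudo-metric on $\tilde X_{GG'}$ and a metric on $\hat X_{GG'}$. Moreover, for any $\tilde x,\tilde x'\in\tilde X_{GG'}$: $$\tilde X_{GG'}[\tilde x]=\tilde X_{GG'}[\tilde x']\ \Leftrightarrow\ \tilde d^\theta_{E'}(\tilde x,\tilde x')=0 .$$
   Context: All graphs are finite, simple and undirected; an edge $\{v,w\}$ is also written $vw$. Paths and cycles have no repeated nodes and are identified with their edge sets. For distinct $v,w\in V$, $vw\text{ -paths}(G)$ is the set of all paths in $G$ from $v$ to $w$; a $vw$-cut of $G$ is an inclusion-minimal set $C\subseteq E$ such that $v$ and $w$ are not connected in $(V,E\setminus C)$, and $vw\text{ -cuts}(G)$ is the set of all of these. For a connected graph $G=(V,E)$ and a graph $G'=(V,E')$ with $E\subseteq E'$, let $F_{GG'}:=E'\setminus E$ and let $X_{GG'}$ be the set of all $x\in\{0,1\}^{E'}$ such that (i) $x_e\le\sum_{e'\in C\setminus\{e\}}x_{e'}$ for every cycle $C$ of $G$ and every $e\in C$; (ii) $x_{vw}\le\sum_{e\in P}x_e$ for every $vw\in F_{GG'}$ and every $P\in vw\text{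 -paths}(G)$; (iii) $1-x_{vw}\le\sum_{e\in C}(1-x_e)$ for every $vw\in F_{GG'}$ and every $C\in vw\text{ -cuts}(G)$. $\{0,1,*\}^{E'}:=\bigcup_{F\subseteq E'}\{0,1\}^F$ is the set of partial functions from $E'$ to $\{0,1\}$; $\operatorname{dom}\tilde x$ denotes the domain. Let $X_{GG'}[\tilde x]:=\{x\in X_{GG'}\mid \forall e\in\operatorname{dom}\tilde x:\ x_e=\tilde x_e\}$, $\tilde X_{GG'}:=\{\tilde x\in\{0,1,*\}^{E'}\mid X_{GG'}[\tilde x]\ne\emptyset\}$, and, for $\tilde x\in\tilde X_{GG'}$, $\tilde X_{GG'}[\tilde x]:=\{\tilde x'\in\tilde X_{GG'}\mid X_{GG'}[\tilde x']=X_{GG'}[\tilde x]\}$. On $\tilde X_{GG'}$, define $\tilde x\le\tilde x'$ iff $\operatorname{dom}\tilde x\subseteq\operatorname{dom}\tilde x'$ and $\tilde x_e=\tilde x'_e$ for all $e\in\operatorname{dom}\tilde x$; this is a partial order. The closure $\operatorname{cl}_{GG'}\tilde x$ is the unique maximum of $\tilde X_{GG'}[\tilde x]$ w.r.t. $\le$ (which exists). $\hat X_{GG'}:=\{\tilde x\in\tilde X_{GG'}\mid\tilde x=\operatorname{cl}_{GG'}\tilde x\}$. For $\tilde x,\tilde x'\in\{0,1,*\}^{E'}$ and $e\in E'$: $d^\theta_e(\tilde x,\tilde x')=1$ if $e\in\operatorname{dom}\tilde x\cap\operatorname{dom}\tilde x'$ and $\tilde x_e\ne\tilde x'_e$; $d^\theta_e(\tilde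 x,\tilde x')=0$ if $e\in\operatorname{dom}\tilde x\cap\operatorname{dom}\tilde x'$ and $\tilde x_e=\tilde x'_e$, or if $e\notin\operatorname{dom}\tilde x\cup\operatorname{dom}\tilde x'$; and $d^\theta_e(\tilde x,\tilde x')=\theta$ otherwise. $d^\theta_{E'}(\tilde x,\tilde x'):=\sum_{e\in E'}d^\theta_e(\tilde x,\tilde x')$. A pseudo-metric satisfies all axioms of a metric except that distinct points may have distance $0$. -}

module Defs where

open import Level using (0ℓ; _⊔_)
open import Algebra.Bundles.Raw using (RawMonoid)
import Algebra.Definitions.RawMonoid as RawMonoidDefinitions
open import Algebra.Core using (Op₂)
open import Data.Bool.Base using (Bool; true; false; if_then_else_)
import Data.Bool.Properties as Bool
open import Data.Fin.Base using (Fin)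
open import Data.Fin.Properties using (any?; all?; _≟_)
open import Data.Fin.Subset
  using (Subset; _∈_; _∉_; _⊆_; _⊂_; _∪_; _─_; _-_; ⁅_⁆; ⊥)
open import Data.Fin.Subset.Induction using (⊂-wellFounded)
open import Data.Fin.Subset.Properties
  using (_∈?_; _⊆?_; _⊂?_; anySubset?; x∈⁅x⁆; p⊆p∪q; q⊆p∪q)
open import Data.Maybe.Base using (Maybe; just; nothing; is-just)
import Data.Maybe.Properties as Maybe
open import Data.Nat.Base as ℕ using (ℕ; _∸_)
import Data.Nat.Properties as ℕ
open import Data.Product using (Σ; ∃; ∃!; _×_; _,_; proj₁; proj₂)
open import Data.Product.Properties using (≡-dec)
open import Data.Rational.Base as ℚ using (ℚ; 0ℚ; 1ℚ)
import Data.Rational.Properties as ℚ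
open import Data.Rational.Solver using (module +-*-Solver)
open import Data.Sum.Base using (_⊎_; inj₁; inj₂)
open import Data.Vec.Base as Vec using (Vec; lookup; tabulate)
import Data.Vec.Properties as Vec
open import Data.Vec.Relation.Binary.Pointwise.Extensional using (ext; Pointwise-≡⇒≡)
open import Function.Base using (_∘_; _on_)
open import Function.Metric.Core using (DistanceFunction)
import Function.Metric.Definitions as MetricDefinitions
import Function.Metric.Structures as MetricStructures
open import Induction.WellFounded using (module All)
open import Relation.Binary.Core using (Rel)
open import Relation.Binary.PropositionalEquality
  using (_≡_; refl; sym; trans; cong; subst)
open import Relation.Nullary
  using (¬_; Dec; yes; no; does; contradiction; ¬?; _×-dec_; _⊎-dec_; _→-dec_)
open import Relation.Nullary.Decidable using (map′; decidable-stable)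
open import Relation.Unary using (Pred; Decidable; _≐_)

-- Real numbers as Cauchy sequences of rationals, identified by _≈ᴿ_ when
-- their difference is a null sequence.

record ℝ : Set where
  constructor mkℝ
  field
    seq    : ℕ → ℚ
    cauchy : ∀ ε → 0ℚ ℚ.< ε → ∃ λ N → ∀ j k → N ℕ.≤ j → N ℕ.≤ k →
             ℚ.∣ seq j ℚ.- seq k ∣ ℚ.≤ ε

open ℝ public

infix 4 _≈ᴿ_ _≤ᴿ_
infixl 6 _+ᴿ_

_≈ᴿ_ : Rel ℝ 0ℓ
x ≈ᴿ y = ∀ ε → 0ℚ ℚ.< ε → ∃ λ N → ∀ k → N ℕ.≤ k →
         ℚ.∣ seq x k ℚ.- seq y k ∣ ℚ.≤ ε

_≤ᴿ_ : Rel ℝ 0ℓ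
x ≤ᴿ y = ∀ ε → 0ℚ ℚ.< ε → ∃ λ N → ∀ k → N ℕ.≤ k →
         seq x k ℚ.≤ seq y k ℚ.+ ε

fromℚ : ℚ → ℝ
fromℚ q = mkℝ (λ _ → q) λ ε 0<ε → 0 , λ _ _ _ _ →
  subst (λ r → ℚ.∣ r ∣ ℚ.≤ ε) (sym (ℚ.+-inverseʳ q)) (ℚ.<⇒≤ 0<ε)

0ℝ 1ℝ ½ℝ : ℝ
0ℝ = fromℚ 0ℚ
1ℝ = fromℚ 1ℚ
½ℝ = fromℚ ℚ.½

_+ᴿ_ : Op₂ ℝ
x +ᴿ y = mkℝ (λ k → seq x k ℚ.+ seq y k) sum-cauchy
  where
  interchange : ∀ a b c d →
    (a ℚ.+ b) ℚ.- (c ℚ.+ d) ≡ (a ℚ.- c) ℚ.+ (b ℚ.- d)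
  interchange = solve 4
    (λ a b c d → (a :+ b) :- (c :+ d) := (a :- c) :+ (b :- d)) refl
    where open +-*-Solver

  halves : ∀ ε → ℚ.½ ℚ.* ε ℚ.+ ℚ.½ ℚ.* ε ≡ ε
  halves ε = trans (sym (ℚ.*-distribʳ-+ ε ℚ.½ ℚ.½)) (ℚ.*-identityˡ ε)

  half-positive : ∀ ε → 0ℚ ℚ.< ε → 0ℚ ℚ.< ℚ.½ ℚ.* ε
  half-positive ε 0<ε =
    subst (ℚ._< ℚ.½ ℚ.* ε) (ℚ.*-zeroʳ ℚ.½) (ℚ.*-monoʳ-<-pos ℚ.½ 0<ε)

  sum-cauchy : ∀ ε → 0ℚ ℚ.< ε → ∃ λ N → ∀ j k → N ℕ.≤ j → N ℕ.≤ k →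
    ℚ.∣ (seq x j ℚ.+ seq y j) ℚ.- (seq x k ℚ.+ seq y k) ∣ ℚ.≤ ε
  sum-cauchy ε 0<ε
    with cauchy x (ℚ.½ ℚ.* ε) (half-positive ε 0<ε)
       | cauchy y (ℚ.½ ℚ.* ε) (half-positive ε 0<ε)
  ... | M , M-ok | N , N-ok = M ℕ.⊔ N , λ j k j≥ k≥ → begin
    ℚ.∣ (seq x j ℚ.+ seq y j) ℚ.- (seq x k ℚ.+ seq y k) ∣
      ≡⟨ cong ℚ.∣_∣ (interchange (seq x j) (seq y j) (seq x k) (seq y k)) ⟩
    ℚ.∣ (seq x j ℚ.- seq x k) ℚ.+ (seq y j ℚ.- seq y k) ∣
      ≤⟨ ℚ.∣p+q∣≤∣p∣+∣q∣ (seq x j ℚ.- seq x k) (seq y j ℚ.- seq y k) ⟩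
    ℚ.∣ seq x j ℚ.- seq x k ∣ ℚ.+ ℚ.∣ seq y j ℚ.- seq y k ∣
      ≤⟨ ℚ.+-mono-≤
           (M-ok j k (ℕ.m⊔n≤o⇒m≤o M N j≥) (ℕ.m⊔n≤o⇒m≤o M N k≥))
           (N-ok j k (ℕ.m⊔n≤o⇒n≤o M N j≥) (ℕ.m⊔n≤o⇒n≤o M N k≥)) ⟩
    ℚ.½ ℚ.* ε ℚ.+ ℚ.½ ℚ.* ε
      ≡⟨ halves ε ⟩
    ε ∎
    where open ℚ.≤-Reasoning

+ᴿ-0-rawMonoid : RawMonoid 0ℓ 0ℓ
+ᴿ-0-rawMonoid = record
  { Carrier = ℝ ; _≈_ = _≈ᴿ_ ; _∙_ = _+ᴿ_ ; ε = 0ℝ }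

open RawMonoidDefinitions +ᴿ-0-rawMonoid public
  using () renaming (sum to sumᴿ)
open RawMonoidDefinitions ℕ.+-0-rawMonoid public
  using () renaming (sum to sumℕ)

module _ {a ℓ} {A : Set a} (_≈_ : Rel A ℓ) where

  open MetricStructures _≈_ _≈ᴿ_ _≤ᴿ_ 0ℝ

  record IsPseudoMetric (d : DistanceFunction A ℝ) : Set (a ⊔ ℓ) where
    field
      isPreMetric : IsPreMetric d
      symmetric   : MetricDefinitions.Symmetric _≈ᴿ_ d
      triangle    : MetricDefinitions.TriangleInequality _≤ᴿ_ _+ᴿ_ d

    open IsPreMetric isPreMetric public

  IsMetric : DistanceFunction A ℝ → Set (a ⊔ ℓ)
  IsMetric = IsGeneralMetric _+ᴿ_

-- A finite simple graph with node set Fin n and edge set Fin m; the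
-- order of the two end nodes of an edge carries no information.  Graphs
-- (V , E) with E contained in the edge set Fin m are given by
-- E : Subset m.

record Graph (n m : ℕ) : Set where
  field
    ends : Fin m → Fin n × Fin n

  Joins : Fin m → Fin n → Fin n → Set
  Joins e v w = ends e ≡ (v , w) ⊎ ends e ≡ (w , v)

  field
    loopless   : ∀ {e v} → ¬ Joins e v v
    noParallel : ∀ {e f v w} → Joins e v w → Joins f v w → e ≡ f

-- true encodes 1, false encodes 0; a partial labelling is nothing outside
-- its domain.

Labelling PartialLabelling : ℕ → Set
Labelling m        = Vec Bool m
PartialLabelling m = Vec (Maybe Bool) m

value : ∀ {m} → Labelling m → Fin m → ℕ
value x e = if lookup x e then 1 else 0

∑[_]_ : ∀ {m} → Subset m → (Fin m → ℕ) → ℕ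
∑[ S ] f = sumℕ (λ e → if does (e ∈? S) then f e else 0)

dom : ∀ {m} → PartialLabelling m → Subset m
dom = Vec.map is-just

infix 4 _⊑_

_⊑_ : ∀ {m} → Rel (PartialLabelling m) 0ℓ
x̃ ⊑ ỹ = dom x̃ ⊆ dom ỹ × (∀ {e} → e ∈ dom x̃ → lookup x̃ e ≡ lookup ỹ e)

module _ {n m : ℕ} (G′ : Graph n m) where

  open Graph G′

  -- Path E v w N P : a path from v to w in (V , E) without repeated
  -- nodes, with node set N and edge set P.

  data Path (E : Subset m) : Fin n → Fin n → Subset n → Subset m → Set where
    []  : ∀ {v} → Path E v v ⁅ v ⁆ ⊥
    _∷_ : ∀ {e u v w N P} →
          e ∈ E × Joins e u v × u ∉ N → Path E v w N P →
          Path E u w (⁅ u ⁆ ∪ N) (⁅ e ⁆ ∪ P)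

  IsPath : Subset m → Fin n → Fin n → Pred (Subset m) 0ℓ
  IsPath E v w P = ∃ λ N → Path E v w N P

  -- Since there are no loops or parallel edges, e ∉ P forces the path
  -- to have at least two edges.

  IsCycle : Subset m → Pred (Subset m) 0ℓ
  IsCycle E C = ∃ λ v → ∃ λ w → ∃ λ e → ∃ λ P →
    IsPath E v w P × e ∈ E × Joins e w v × e ∉ P × C ≡ ⁅ e ⁆ ∪ P

  ConnectedNodes : Subset m → Rel (Fin n) 0ℓ
  ConnectedNodes E v w = ∃ λ P → IsPath E v w P

  Connected : Subset m → Set
  Connected E = ∀ v w → ConnectedNodes E v w

  Separates : Subset m → Fin n → Fin n → Pred (Subset m) 0ℓ
  Separates E v w C = C ⊆ E × ¬ ConnectedNodes (E ─ C) v w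

  IsCut : Subset m → Fin n → Fin n → Pred (Subset m) 0ℓ
  IsCut E v w C = Separates E v w C × (∀ {D} → D ⊂ C → ¬ Separates E v w D)

-- The closure exists constructively because membership in X is decidable,
-- which is what the following private lemmas establish.

private

  Σ-dec : ∀ {a b} {A : Set a} {B : A → Set b} →
          Dec A → (∀ x → Dec (B x)) → (∀ x y → B x → B y) → Dec (Σ A B)
  Σ-dec (no ¬a) _  _ = no (¬a ∘ proj₁)
  Σ-dec (yes a) B? f = map′ (a ,_) (λ (a′ , b) → f a′ a b) (B? a)

  allSubset? : ∀ {n ℓ} {P : Pred (Subset n) ℓ} → Decidable P → Dec (∀ S → P S)
  allSubset? P? = map′
    (λ ¬∃¬ S → decidable-stable (P? S) (λ ¬p → ¬∃¬ (S , ¬p)))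
    (λ ∀p (S , ¬p) → ¬p (∀p S))
    (¬? (anySubset? (¬? ∘ P?)))

  _≟ₛ_ : ∀ {n} (S T : Subset n) → Dec (S ≡ T)
  _≟ₛ_ = Vec.≡-dec Bool._≟_

  ⊂-insert : ∀ {n} {u : Fin n} {N N′ : Subset n} →
             u ∉ N′ × N ≡ ⁅ u ⁆ ∪ N′ → N′ ⊂ N
  ⊂-insert {u = u} {N′ = N′} (u∉N′ , refl) =
    q⊆p∪q ⁅ u ⁆ N′ , u , p⊆p∪q N′ (x∈⁅x⁆ u) , u∉N′

  module Decide {n m : ℕ} (G′ : Graph n m) where

    open Graph G′

    joins? : ∀ e v w → Dec (Joins e v w)
    joins? e v w = ≡-dec _≟_ _≟_ (ends e) (v , w) ⊎-dec
                   ≡-dec _≟_ _≟_ (ends e) (w , v)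

    Unfolded : Subset m → Fin n → Fin n → Subset n → Subset m → Set
    Unfolded E u w N P =
      (u ≡ w × N ≡ ⁅ u ⁆ × P ≡ ⊥) ⊎
      (∃ λ e → ∃ λ v → ∃ λ N′ → ∃ λ P′ →
        (u ∉ N′ × N ≡ ⁅ u ⁆ ∪ N′) ×
        (e ∈ E × Joins e u v × P ≡ ⁅ e ⁆ ∪ P′ × Path G′ E v w N′ P′))

    fold : ∀ {E u w N P} → Unfolded E u w N P → Path G′ E u w N P
    fold (inj₁ (refl , refl , refl)) = []
    fold (inj₂ (_ , _ , _ , _ , (u∉ , refl) , e∈E , j , refl , p)) =
      (e∈E , j , u∉) ∷ p

    unfold : ∀ {E u w N P} → Path G′ E u w N P → Unfolded E u w N P
    unfold []                 = inj₁ (refl , refl , refl)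
    unfold ((e∈E , j , u∉) ∷ p) =
      inj₂ (_ , _ , _ , _ , (u∉ , refl) , e∈E , j , refl , p)

    pathStep? : ∀ E u w N P →
      (∀ v {N′} P′ → N′ ⊂ N → Dec (Path G′ E v w N′ P′)) →
      Dec (Path G′ E u w N P)
    pathStep? E u w N P rec? = map′ fold unfold
      ((u ≟ w ×-dec N ≟ₛ ⁅ u ⁆ ×-dec P ≟ₛ ⊥) ⊎-dec
       any? λ e → any? λ v → anySubset? λ N′ → anySubset? λ P′ →
         Σ-dec (¬? (u ∈? N′) ×-dec (N ≟ₛ (⁅ u ⁆ ∪ N′)))
           (λ h → e ∈? E ×-dec joins? e u v ×-dec P ≟ₛ (⁅ e ⁆ ∪ P′) ×-dec
                  rec? v P′ (⊂-insert h))
           (λ _ _ b → b))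

    path? : ∀ E u w N P → Dec (Path G′ E u w N P)
    path? E u w N P = All.wfRec ⊂-wellFounded 0ℓ
      (λ N → ∀ u P → Dec (Path G′ E u w N P))
      (λ N rec? u P → pathStep? E u w N P (λ v P′ N′⊂N → rec? N′⊂N v P′))
      N u P

    isPath? : ∀ E v w P → Dec (IsPath G′ E v w P)
    isPath? E v w P = anySubset? λ N → path? E v w N P

    isCycle? : ∀ E C → Dec (IsCycle G′ E C)
    isCycle? E C = any? λ v → any? λ w → any? λ e → anySubset? λ P →
      isPath? E v w P ×-dec e ∈? E ×-dec joins? e w v ×-dec
      ¬? (e ∈? P) ×-dec C ≟ₛ (⁅ e ⁆ ∪ P)

    separates? : ∀ E v w C → Dec (Separates G′ E v w C)
    separates? E v w C = C ⊆? E ×-dec ¬? (anySubset? (isPath? (E ─ C) v w))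

    isCut? : ∀ E v w C → Dec (IsCut G′ E v w C)
    isCut? E v w C = separates? E v w C ×-dec
      map′ (λ f {D} → f D) (λ f D → f {D})
        (allSubset? λ D → D ⊂? C →-dec ¬? (separates? E v w D))

  ∈dom⁺ : ∀ {m} (x̃ : PartialLabelling m) {e b} → lookup x̃ e ≡ just b → e ∈ dom x̃
  ∈dom⁺ x̃ {e} eq = Vec.lookup⇒[]= e (dom x̃)
    (trans (Vec.lookup-map e is-just x̃) (cong is-just eq))

  ∈dom⁻ : ∀ {m} (x̃ : PartialLabelling m) {e} → e ∈ dom x̃ →
          ∃ λ b → lookup x̃ e ≡ just b
  ∈dom⁻ x̃ {e} e∈ with lookup x̃ e in eq
  ... | just b  = b , refl
  ... | nothing with trans (sym (Vec.[]=⇒lookup e∈))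
                       (trans (Vec.lookup-map e is-just x̃) (cong is-just eq))
  ...   | ()

  ⊑-antisym : ∀ {m} {x̃ ỹ : PartialLabelling m} → x̃ ⊑ ỹ → ỹ ⊑ x̃ → x̃ ≡ ỹ
  ⊑-antisym {x̃ = x̃} {ỹ} (_ , f) (_ , g) = Pointwise-≡⇒≡ (ext pointwise)
    where
    pointwise : ∀ e → lookup x̃ e ≡ lookup ỹ e
    pointwise e with lookup x̃ e in p | lookup ỹ e in q
    ... | nothing | nothing = refl
    ... | just _  | _       = trans (sym p) (trans (f (∈dom⁺ x̃ p)) q)
    ... | nothing | just _  = trans (sym p) (trans (sym (g (∈dom⁺ ỹ q))) q)

module _ {n m : ℕ} (G′ : Graph n m) (E : Subset m) where

  open Graph G′

  -- Truncated subtraction is exact in 1 ∸ value x e, as value x e is 0 or 1.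

  record X (x : Labelling m) : Set where
    constructor mkX
    field
      cycle-inequality : ∀ {C e} → IsCycle G′ E C → e ∈ C →
        value x e ℕ.≤ ∑[ C - e ] value x
      path-inequality  : ∀ {f v w P} → f ∉ E → Joins f v w →
        IsPath G′ E v w P → value x f ℕ.≤ ∑[ P ] value x
      cut-inequality   : ∀ {f v w C} → f ∉ E → Joins f v w →
        IsCut G′ E v w C → 1 ∸ value x f ℕ.≤ ∑[ C ] (λ e → 1 ∸ value x e)

  X[_] : PartialLabelling m → Pred (Labelling m) 0ℓ
  X[ x̃ ] x = X x × (∀ {e} → e ∈ dom x̃ → just (lookup x e) ≡ lookup x̃ e)

  -- The witness of X[ x̃ ] being nonempty is irrelevant for _≈~_.

  X~ : Set
  X~ = Σ (PartialLabelling m) λ x̃ → ∃ X[ x̃ ]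

  _≈~_ : Rel X~ 0ℓ
  _≈~_ = _≡_ on proj₁

  _⊑~_ : Rel X~ 0ℓ
  _⊑~_ = _⊑_ on proj₁

  X~[_] : X~ → Pred X~ 0ℓ
  X~[ x̃ ] ỹ = X[ proj₁ ỹ ] ≐ X[ proj₁ x̃ ]

  IsMaximumOf : Pred X~ 0ℓ → Pred X~ 0ℓ
  IsMaximumOf S ỹ = S ỹ × (∀ z̃ → S z̃ → z̃ ⊑~ ỹ)

  private

    open Decide G′

    X? : Decidable X
    X? x = map′
      (λ (a , b , c) → mkX (a _ _) (b _ _ _ _) (c _ _ _ _))
      (λ (mkX a b c) → (λ _ _ → a) , (λ _ _ _ _ → b) , (λ _ _ _ _ → c))
      ((allSubset? λ C → all? λ e → isCycle? E C →-dec e ∈? C →-dec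
          value x e ℕ.≤? ∑[ C - e ] value x) ×-dec
       (all? λ f → all? λ v → all? λ w → allSubset? λ P →
          ¬? (f ∈? E) →-dec joins? f v w →-dec isPath? E v w P →-dec
          value x f ℕ.≤? ∑[ P ] value x) ×-dec
       (all? λ f → all? λ v → all? λ w → allSubset? λ C →
          ¬? (f ∈? E) →-dec joins? f v w →-dec isCut? E v w C →-dec
          1 ∸ value x f ℕ.≤? ∑[ C ] (λ e → 1 ∸ value x e)))

    X[_]? : ∀ x̃ → Decidable X[ x̃ ]
    X[ x̃ ]? x = X? x ×-dec
      map′ (λ f {e} → f e) (λ f e → f {e})
        (all? λ e → e ∈? dom x̃ →-dec
          Maybe.≡-dec Bool._≟_ (just (lookup x e)) (lookup x̃ e))

    Forced : PartialLabelling m → Fin m → Bool → Set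
    Forced x̃ e b = ∀ x → X[ x̃ ] x → lookup x e ≡ b

    opaque
      forced? : ∀ x̃ e b → Dec (Forced x̃ e b)
      forced? x̃ e b = allSubset? λ x → X[ x̃ ]? x →-dec lookup x e Bool.≟ b

    forcedValue : PartialLabelling m → Fin m → Maybe Bool
    forcedValue x̃ e with forced? x̃ e true | forced? x̃ e false
    ... | yes _ | _     = just true
    ... | no _  | yes _ = just false
    ... | no _  | no _  = nothing

    forcedValue-sound : ∀ x̃ e {b} → forcedValue x̃ e ≡ just b → Forced x̃ e b
    forcedValue-sound x̃ e eq with forced? x̃ e true | forced? x̃ e false
    forcedValue-sound x̃ e refl | yes h | _     = h
    forcedValue-sound x̃ e refl | no _  | yes h = h

    forcedValue-complete : ∀ x̃ e {b} → ∃ X[ x̃ ] → Forced x̃ e b →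
                           forcedValue x̃ e ≡ just b
    forcedValue-complete x̃ e {b} (x , x∈) h
      with forced? x̃ e true | forced? x̃ e false
    ... | yes h′ | _      = cong just (trans (sym (h′ x x∈)) (h x x∈))
    ... | no _   | yes h′ = cong just (trans (sym (h′ x x∈)) (h x x∈))
    forcedValue-complete x̃ e {true}  _ h | no ¬h | no _  = contradiction h ¬h
    forcedValue-complete x̃ e {false} _ h | no _  | no ¬h = contradiction h ¬h

  opaque
    closure : ∀ x̃ → ∃! _≈~_ (IsMaximumOf X~[ x̃ ])
    closure (x̃ , x₀ , x₀∈) = c~ , ((c⊆ , ⊆c) , maximal) , λ {ỹ} → unique {ỹ}
      where
      c : PartialLabelling m
      c = tabulate (forcedValue x̃)

      ⊆c : ∀ {x} → X[ x̃ ] x → X[ c ] x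
      ⊆c {x} x∈@(x∈X , _) = x∈X , agree
        where
        agree : ∀ {e} → e ∈ dom c → just (lookup x e) ≡ lookup c e
        agree {e} e∈ with ∈dom⁻ c e∈
        ... | b , eq = trans
          (cong just (forcedValue-sound x̃ e
            (trans (sym (Vec.lookup∘tabulate (forcedValue x̃) e)) eq) x x∈))
          (sym eq)

      below : ∀ z̃ → (∀ {x} → X[ x̃ ] x → X[ z̃ ] x) → z̃ ⊑ c
      below z̃ x̃⊆z̃ = (λ e∈ → ∈dom⁺ c (eq-c e∈)) ,
                     (λ e∈ → trans (proj₂ (∈dom⁻ z̃ e∈)) (sym (eq-c e∈)))
        where
        eq-c : ∀ {e} (e∈ : e ∈ dom z̃) → lookup c e ≡ just (proj₁ (∈dom⁻ z̃ e∈))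
        eq-c {e} e∈ = trans (Vec.lookup∘tabulate (forcedValue x̃) e)
          (forcedValue-complete x̃ e (x₀ , x₀∈)
            (λ x x∈ → Maybe.just-injective
              (trans (proj₂ (x̃⊆z̃ x∈) e∈) (proj₂ (∈dom⁻ z̃ e∈)))))

      c⊆ : ∀ {x} → X[ c ] x → X[ x̃ ] x
      c⊆ (x∈X , x∼c) = x∈X , λ e∈ →
        trans (x∼c (proj₁ x̃⊑c e∈)) (sym (proj₂ x̃⊑c e∈))
        where
        x̃⊑c : x̃ ⊑ c
        x̃⊑c = below x̃ (λ h → h)

      c~ : X~
      c~ = c , x₀ , ⊆c x₀∈

      maximal : ∀ z̃ → X~[ x̃ , x₀ , x₀∈ ] z̃ → z̃ ⊑~ c~
      maximal z̃ (_ , x̃⊆z̃) = below (proj₁ z̃) x̃⊆z̃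

      unique : ∀ {ỹ} → IsMaximumOf X~[ x̃ , x₀ , x₀∈ ] ỹ → c~ ≈~ ỹ
      unique {ỹ} (ỹ∈ , ỹ-max) =
        ⊑-antisym (ỹ-max c~ (c⊆ , ⊆c)) (maximal ỹ ỹ∈)

  cl : X~ → X~
  cl x̃ = proj₁ (closure x̃)

  X^ : Set
  X^ = Σ X~ λ x̃ → x̃ ≈~ cl x̃

  _≈^_ : Rel X^ 0ℓ
  _≈^_ = _≈~_ on proj₁

dₑ : ℝ → Maybe Bool → Maybe Bool → ℝ
dₑ θ (just a) (just b) = if does (a Bool.≟ b) then 0ℝ else 1ℝ
dₑ θ nothing  nothing  = 0ℝ
dₑ θ (just _) nothing  = θ
dₑ θ nothing  (just _) = θ

d : ∀ {m} → ℝ → DistanceFunction (PartialLabelling m) ℝ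
d θ x̃ ỹ = sumᴿ λ e → dₑ θ (lookup x̃ e) (lookup ỹ e)

module _ {n m : ℕ} (G′ : Graph n m) (E : Subset m) (θ : ℝ) where

  d~ : DistanceFunction (X~ G′ E) ℝ
  d~ x̃ ỹ = d θ (proj₁ (cl G′ E x̃)) (proj₁ (cl G′ E ỹ))

  d^ : DistanceFunction (X^ G′ E) ℝ
  d^ = d~ on proj₁

{-# OPTIONS --safe #-}

-- The summand d^θ_e takes the value 0 on the diagonal of {0,1,*} and values
-- in [½, 1] off it, so it is a metric: if neither summand on the right
-- vanishes, the triangle inequality follows from 1 ≤ ½ + ½.  Hence
-- d^θ is a metric on partial labellings, and d~ is its pullback along the
-- closure, which depends only on the set X[ x̃ ] and determines it.

module Submission where

open import Defs
open import Algebra.Bundles using (CommutativeMonoid)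
import Algebra.Properties.CommutativeMonoid.Sum as Sum
open import Data.Bool.Base using (Bool; true; false)
import Data.Bool.Properties as Bool
open import Data.Fin.Base using (Fin; zero; suc)
open import Data.Fin.Subset using (Subset)
open import Data.Maybe.Base using (Maybe; just; nothing)
import Data.Maybe.Properties as Maybe
open import Data.Nat.Base as ℕ using (ℕ; zero; suc)
import Data.Nat.Properties as ℕ
open import Data.Product using (_×_; _,_; proj₁; proj₂)
open import Data.Rational.Base as ℚ using (ℚ; 0ℚ; 1ℚ; ½)
import Data.Rational.Properties as ℚ
open import Data.Rational.Solver using (module +-*-Solver)
open import Data.Sum.Base using (inj₁; inj₂)
open import Data.Vec.Base using (lookup)
open import Data.Vec.Functional using (head; tail)
open import Data.Vec.Relation.Binary.Pointwise.Extensional using (ext; Pointwise-≡⇒≡)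
open import Function.Bundles using (_⇔_; mk⇔)
open import Level using (0ℓ)
open import Relation.Binary.Bundles using (Poset)
open import Relation.Binary.Structures using (IsEquivalence; IsPartialOrder)
import Relation.Binary.Construct.On as On
import Relation.Binary.Reasoning.PartialOrder as ≤-Reasoning
open import Relation.Binary.PropositionalEquality
  using (_≡_; _≢_; refl; sym; trans; cong; cong₂; subst; isEquivalence)
open import Relation.Nullary using (¬_; Dec; yes; no; contradiction)
open import Relation.Nullary.Decidable using (decidable-stable; from-yes; from-no)
open import Relation.Unary using (_≐_)
open import Relation.Unary.Properties using (≐-refl; ≐-sym; ≐-trans)

-- Since _≈ᴿ_ and _≤ᴿ_ unfold to statements about sequences, from which a
-- real cannot be inferred, lemmas about reals take them explicitly.

0<½*ε : ∀ {ε} → 0ℚ ℚ.< ε → 0ℚ ℚ.< ½ ℚ.* ε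
0<½*ε {ε} 0<ε =
  subst (ℚ._< ½ ℚ.* ε) (ℚ.*-zeroʳ ½) (ℚ.*-monoʳ-<-pos ½ 0<ε)

p≤q+∣p-q∣ : ∀ p q → p ℚ.≤ q ℚ.+ ℚ.∣ p ℚ.- q ∣
p≤q+∣p-q∣ p q = begin
  p                        ≡⟨ solve 2 (λ p q → p := q :+ (p :- q)) refl p q ⟩
  q ℚ.+ (p ℚ.- q)          ≤⟨ ℚ.+-monoʳ-≤ q (r≤∣r∣ (p ℚ.- q)) ⟩
  q ℚ.+ ℚ.∣ p ℚ.- q ∣      ∎
  where
  open ℚ.≤-Reasoning
  open +-*-Solver
  r≤∣r∣ : ∀ r → r ℚ.≤ ℚ.∣ r ∣
  r≤∣r∣ r with ℚ.≤-total 0ℚ r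
  ... | inj₁ 0≤r = ℚ.≤-reflexive (sym (ℚ.0≤p⇒∣p∣≡p 0≤r))
  ... | inj₂ r≤0 = ℚ.≤-trans r≤0 (ℚ.0≤∣p∣ r)

p≤q+r⇒p-q≤r : ∀ {p q r} → p ℚ.≤ q ℚ.+ r → p ℚ.- q ℚ.≤ r
p≤q+r⇒p-q≤r {p} {q} {r} p≤q+r = begin
  p ℚ.- q            ≤⟨ ℚ.+-monoˡ-≤ (ℚ.- q) p≤q+r ⟩
  (q ℚ.+ r) ℚ.- q    ≡⟨ solve 2 (λ q r → (q :+ r) :- q := r) refl q r ⟩
  r                  ∎
  where
  open ℚ.≤-Reasoning
  open +-*-Solver

∣p-q∣≤r : ∀ {p q r} → p ℚ.≤ q ℚ.+ r → q ℚ.≤ p ℚ.+ r → ℚ.∣ p ℚ.- q ∣ ℚ.≤ r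
∣p-q∣≤r {p} {q} {r} p≤q+r q≤p+r with ℚ.∣p∣≡p∨∣p∣≡-p (p ℚ.- q)
... | inj₁ eq = subst (ℚ._≤ r) (sym eq) (p≤q+r⇒p-q≤r p≤q+r)
... | inj₂ eq = subst (ℚ._≤ r)
  (trans (solve 2 (λ p q → q :- p := :- (p :- q)) refl p q) (sym eq))
  (p≤q+r⇒p-q≤r q≤p+r)
  where open +-*-Solver

-- The reals as an ordered commutative monoid under addition.

pointwise-≤ : ∀ x y → (∀ k → seq x k ℚ.≤ seq y k) → x ≤ᴿ y
pointwise-≤ x y x≤y ε 0<ε = 0 , λ k _ → begin
  seq x k            ≤⟨ x≤y k ⟩
  seq y k            ≡⟨ ℚ.+-identityʳ (seq y k) ⟨
  seq y k ℚ.+ 0ℚ     ≤⟨ ℚ.+-monoʳ-≤ (seq y k) (ℚ.<⇒≤ 0<ε) ⟩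
  seq y k ℚ.+ ε      ∎
  where open ℚ.≤-Reasoning

≤ᴿ-refl : ∀ x → x ≤ᴿ x
≤ᴿ-refl x = pointwise-≤ x x (λ _ → ℚ.≤-refl)

≤ᴿ-trans : ∀ x y z → x ≤ᴿ y → y ≤ᴿ z → x ≤ᴿ z
≤ᴿ-trans x y z x≤y y≤z ε 0<ε
  with x≤y (½ ℚ.* ε) (0<½*ε 0<ε) | y≤z (½ ℚ.* ε) (0<½*ε 0<ε)
... | M , M-ok | N , N-ok = M ℕ.⊔ N , λ k k≥ → begin
  seq x k
    ≤⟨ M-ok k (ℕ.m⊔n≤o⇒m≤o M N k≥) ⟩
  seq y k ℚ.+ ½ ℚ.* ε
    ≤⟨ ℚ.+-monoˡ-≤ (½ ℚ.* ε) (N-ok k (ℕ.m⊔n≤o⇒n≤o M N k≥)) ⟩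
  (seq z k ℚ.+ ½ ℚ.* ε) ℚ.+ ½ ℚ.* ε
    ≡⟨ solve 2 (λ z ε → (z :+ con ½ :* ε) :+ con ½ :* ε := z :+ ε) refl (seq z k) ε ⟩
  seq z k ℚ.+ ε ∎
  where
  open ℚ.≤-Reasoning
  open +-*-Solver

-- Two one-sided bounds with the same tolerance bound the absolute difference. Transitivity of
-- `_≈ᴿ_` and `+ᴿ-cong` are derived through this lemma from their counterparts for `_≤ᴿ_`, without a
-- second ε-argument.
≤ᴿ-antisym : ∀ x y → x ≤ᴿ y → y ≤ᴿ x → x ≈ᴿ y
≤ᴿ-antisym x y x≤y y≤x ε 0<ε with x≤y ε 0<ε | y≤x ε 0<ε
... | M , M-ok | N , N-ok = M ℕ.⊔ N , λ k k≥ →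
  ∣p-q∣≤r (M-ok k (ℕ.m⊔n≤o⇒m≤o M N k≥)) (N-ok k (ℕ.m⊔n≤o⇒n≤o M N k≥))

≈ᴿ⇒≤ᴿ : ∀ x y → x ≈ᴿ y → x ≤ᴿ y
≈ᴿ⇒≤ᴿ x y x≈y ε 0<ε with x≈y ε 0<ε
... | N , N-ok = N , λ k k≥ → ℚ.≤-trans
  (p≤q+∣p-q∣ (seq x k) (seq y k)) (ℚ.+-monoʳ-≤ (seq y k) (N-ok k k≥))

≈ᴿ-sym : ∀ x y → x ≈ᴿ y → y ≈ᴿ x
≈ᴿ-sym x y x≈y ε 0<ε with x≈y ε 0<ε
... | N , N-ok = N , λ k k≥ → subst (ℚ._≤ ε)
  (trans (sym (ℚ.∣-p∣≡∣p∣ (seq x k ℚ.- seq y k)))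
    (cong ℚ.∣_∣ (solve 2 (λ p q → :- (p :- q) := q :- p) refl (seq x k) (seq y k))))
  (N-ok k k≥)
  where open +-*-Solver

pointwise-≈ : ∀ x y → (∀ k → seq x k ≡ seq y k) → x ≈ᴿ y
pointwise-≈ x y x≗y = ≤ᴿ-antisym x y
  (pointwise-≤ x y (λ k → ℚ.≤-reflexive (x≗y k)))
  (pointwise-≤ y x (λ k → ℚ.≤-reflexive (sym (x≗y k))))

≡⇒≈ᴿ : ∀ {x y} → x ≡ y → x ≈ᴿ y
≡⇒≈ᴿ {x} refl = pointwise-≈ x x (λ _ → refl)

≈ᴿ-trans : ∀ x y z → x ≈ᴿ y → y ≈ᴿ z → x ≈ᴿ z
≈ᴿ-trans x y z x≈y y≈z = ≤ᴿ-antisym x z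
  (≤ᴿ-trans x y z (≈ᴿ⇒≤ᴿ x y x≈y) (≈ᴿ⇒≤ᴿ y z y≈z))
  (≤ᴿ-trans z y x (≈ᴿ⇒≤ᴿ z y (≈ᴿ-sym y z y≈z)) (≈ᴿ⇒≤ᴿ y x (≈ᴿ-sym x y x≈y)))

≈ᴿ-isEquivalence : IsEquivalence _≈ᴿ_
≈ᴿ-isEquivalence = record
  { refl  = λ {x} → ≡⇒≈ᴿ {x} refl
  ; sym   = λ {x} {y} → ≈ᴿ-sym x y
  ; trans = λ {x} {y} {z} → ≈ᴿ-trans x y z
  }

≤ᴿ-isPartialOrder : IsPartialOrder _≈ᴿ_ _≤ᴿ_
≤ᴿ-isPartialOrder = record
  { isPreorder = record
    { isEquivalence = ≈ᴿ-isEquivalence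
    ; reflexive     = λ {x} {y} → ≈ᴿ⇒≤ᴿ x y
    ; trans         = λ {x} {y} {z} → ≤ᴿ-trans x y z
    }
  ; antisym = λ {x} {y} → ≤ᴿ-antisym x y
  }

≤ᴿ-poset : Poset 0ℓ 0ℓ 0ℓ
≤ᴿ-poset = record { isPartialOrder = ≤ᴿ-isPartialOrder }

+ᴿ-mono-≤ᴿ : ∀ x y u v → x ≤ᴿ y → u ≤ᴿ v → x +ᴿ u ≤ᴿ y +ᴿ v
+ᴿ-mono-≤ᴿ x y u v x≤y u≤v ε 0<ε
  with x≤y (½ ℚ.* ε) (0<½*ε 0<ε) | u≤v (½ ℚ.* ε) (0<½*ε 0<ε)
... | M , M-ok | N , N-ok = M ℕ.⊔ N , λ k k≥ → begin
  seq x k ℚ.+ seq u k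
    ≤⟨ ℚ.+-mono-≤ (M-ok k (ℕ.m⊔n≤o⇒m≤o M N k≥)) (N-ok k (ℕ.m⊔n≤o⇒n≤o M N k≥)) ⟩
  (seq y k ℚ.+ ½ ℚ.* ε) ℚ.+ (seq v k ℚ.+ ½ ℚ.* ε)
    ≡⟨ solve 3 (λ y v ε → (y :+ con ½ :* ε) :+ (v :+ con ½ :* ε) := (y :+ v) :+ ε)
         refl (seq y k) (seq v k) ε ⟩
  (seq y k ℚ.+ seq v k) ℚ.+ ε ∎
  where
  open ℚ.≤-Reasoning
  open +-*-Solver

+ᴿ-cong : ∀ x y u v → x ≈ᴿ y → u ≈ᴿ v → x +ᴿ u ≈ᴿ y +ᴿ v
+ᴿ-cong x y u v x≈y u≈v = ≤ᴿ-antisym (x +ᴿ u) (y +ᴿ v)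
  (+ᴿ-mono-≤ᴿ x y u v (≈ᴿ⇒≤ᴿ x y x≈y) (≈ᴿ⇒≤ᴿ u v u≈v))
  (+ᴿ-mono-≤ᴿ y x v u (≈ᴿ⇒≤ᴿ y x (≈ᴿ-sym x y x≈y)) (≈ᴿ⇒≤ᴿ v u (≈ᴿ-sym u v u≈v)))

+ᴿ-identityˡ : ∀ x → 0ℝ +ᴿ x ≈ᴿ x
+ᴿ-identityˡ x = pointwise-≈ (0ℝ +ᴿ x) x (λ k → ℚ.+-identityˡ (seq x k))

+ᴿ-identityʳ : ∀ x → x +ᴿ 0ℝ ≈ᴿ x
+ᴿ-identityʳ x = pointwise-≈ (x +ᴿ 0ℝ) x (λ k → ℚ.+-identityʳ (seq x k))

-- Its operations are those of `+ᴿ-0-rawMonoid`, so the general lemmas on sums apply to `sumᴿ` by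
-- computation.
+ᴿ-0-commutativeMonoid : CommutativeMonoid 0ℓ 0ℓ
+ᴿ-0-commutativeMonoid = record
  { Carrier = ℝ
  ; _≈_     = _≈ᴿ_
  ; _∙_     = _+ᴿ_
  ; ε       = 0ℝ
  ; isCommutativeMonoid = record
    { isMonoid = record
      { isSemigroup = record
        { isMagma = record
          { isEquivalence = ≈ᴿ-isEquivalence
          ; ∙-cong = λ {x} {y} {u} {v} → +ᴿ-cong x y u v
          }
        ; assoc = λ x y z → pointwise-≈ ((x +ᴿ y) +ᴿ z) (x +ᴿ (y +ᴿ z))
            (λ k → ℚ.+-assoc (seq x k) (seq y k) (seq z k))
        }
      ; identity = +ᴿ-identityˡ , +ᴿ-identityʳ
      }
    ; comm = λ x y → pointwise-≈ (x +ᴿ y) (y +ᴿ x)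
        (λ k → ℚ.+-comm (seq x k) (seq y k))
    }
  }

-- Finite sums of nonnegative reals.

open Sum +ᴿ-0-commutativeMonoid using (sum-cong-≗; sum-replicate-zero; ∑-distrib-+)

x≤x+y : ∀ x y → 0ℝ ≤ᴿ y → x ≤ᴿ x +ᴿ y
x≤x+y x y 0≤y = begin
  x          ≈⟨ +ᴿ-identityʳ x ⟨
  x +ᴿ 0ℝ    ≤⟨ +ᴿ-mono-≤ᴿ x x 0ℝ y (≤ᴿ-refl x) 0≤y ⟩
  x +ᴿ y     ∎
  where open ≤-Reasoning ≤ᴿ-poset

y≤x+y : ∀ x y → 0ℝ ≤ᴿ x → y ≤ᴿ x +ᴿ y
y≤x+y x y 0≤x = begin
  y          ≈⟨ +ᴿ-identityˡ y ⟨
  0ℝ +ᴿ y    ≤⟨ +ᴿ-mono-≤ᴿ 0ℝ x y y 0≤x (≤ᴿ-refl y) ⟩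
  x +ᴿ y     ∎
  where open ≤-Reasoning ≤ᴿ-poset

0≤x+y : ∀ x y → 0ℝ ≤ᴿ x → 0ℝ ≤ᴿ y → 0ℝ ≤ᴿ x +ᴿ y
-- `_≤ᴿ_` sees only the sequences, and `0ℚ ℚ.+ 0ℚ` computes to `0ℚ`, so `0ℝ +ᴿ 0ℝ` may stand for
-- `0ℝ`.
0≤x+y x y = +ᴿ-mono-≤ᴿ 0ℝ x 0ℝ y

sumᴿ-mono-≤ : ∀ {n} (f g : Fin n → ℝ) → (∀ i → f i ≤ᴿ g i) → sumᴿ f ≤ᴿ sumᴿ g
sumᴿ-mono-≤ {zero}  f g f≤g = ≤ᴿ-refl 0ℝ
sumᴿ-mono-≤ {suc n} f g f≤g =
  +ᴿ-mono-≤ᴿ (head f) (head g) (sumᴿ (tail f)) (sumᴿ (tail g))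
    (f≤g zero) (sumᴿ-mono-≤ (tail f) (tail g) (λ i → f≤g (suc i)))

sumᴿ-nonNegative : ∀ {n} (f : Fin n → ℝ) → (∀ i → 0ℝ ≤ᴿ f i) → 0ℝ ≤ᴿ sumᴿ f
sumᴿ-nonNegative {zero}  f 0≤f = ≤ᴿ-refl 0ℝ
sumᴿ-nonNegative {suc n} f 0≤f = 0≤x+y (head f) (sumᴿ (tail f))
  (0≤f zero) (sumᴿ-nonNegative (tail f) (λ i → 0≤f (suc i)))

term≤sumᴿ : ∀ {n} (f : Fin n → ℝ) → (∀ i → 0ℝ ≤ᴿ f i) → ∀ i → f i ≤ᴿ sumᴿ f
term≤sumᴿ f 0≤f zero = x≤x+y (head f) (sumᴿ (tail f))
  (sumᴿ-nonNegative (tail f) (λ i → 0≤f (suc i)))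
term≤sumᴿ f 0≤f (suc i) = begin
  f (suc i)                    ≤⟨ term≤sumᴿ (tail f) (λ i → 0≤f (suc i)) i ⟩
  sumᴿ (tail f)                ≤⟨ y≤x+y (head f) (sumᴿ (tail f)) (0≤f zero) ⟩
  head f +ᴿ sumᴿ (tail f)      ∎
  where open ≤-Reasoning ≤ᴿ-poset

0≤½ : 0ℝ ≤ᴿ ½ℝ
0≤½ = pointwise-≤ 0ℝ ½ℝ (λ _ → from-yes (0ℚ ℚ.≤? ½))

½≤1 : ½ℝ ≤ᴿ 1ℝ
½≤1 = pointwise-≤ ½ℝ 1ℝ (λ _ → from-yes (½ ℚ.≤? 1ℚ))

0≤1 : 0ℝ ≤ᴿ 1ℝ
0≤1 = ≤ᴿ-trans 0ℝ ½ℝ 1ℝ 0≤½ ½≤1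

¼ : ℚ
¼ = ½ ℚ.* ½

-- Any tolerance below ½ refutes the inequality, since both sequences are constant; `¼` is one.
½≰0 : ¬ ½ℝ ≤ᴿ 0ℝ
½≰0 ½≤0 with ½≤0 ¼ (from-yes (0ℚ ℚ.<? ¼))
... | N , N-ok = from-no (½ ℚ.≤? 0ℚ ℚ.+ ¼) (N-ok N ℕ.≤-refl)

-- The distances `dₑ` on labels and `d` on partial labellings.

-- Stated with `_≡_` so that `sum-cong-≗` and `subst` can use it. The Boolean is split because
-- `does (a Bool.≟ a)` computes only on constructors.
dₑ-refl : ∀ θ a → dₑ θ a a ≡ 0ℝ
dₑ-refl θ nothing      = refl
dₑ-refl θ (just true)  = refl
dₑ-refl θ (just false) = refl

dₑ-sym : ∀ θ a b → dₑ θ a b ≡ dₑ θ b a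
dₑ-sym θ nothing      nothing      = refl
dₑ-sym θ nothing      (just _)     = refl
dₑ-sym θ (just _)     nothing      = refl
dₑ-sym θ (just true)  (just true)  = refl
dₑ-sym θ (just true)  (just false) = refl
dₑ-sym θ (just false) (just true)  = refl
dₑ-sym θ (just false) (just false) = refl

d-refl : ∀ {m} θ (x̃ : PartialLabelling m) → d θ x̃ x̃ ≈ᴿ 0ℝ
d-refl {m} θ x̃ = ≈ᴿ-trans (d θ x̃ x̃) (sumᴿ {m} (λ _ → 0ℝ)) 0ℝ
  (≡⇒≈ᴿ (sum-cong-≗ (λ e → dₑ-refl θ (lookup x̃ e))))
  (sum-replicate-zero m)

d-sym : ∀ {m} θ (x̃ ỹ : PartialLabelling m) → d θ x̃ ỹ ≈ᴿ d θ ỹ x̃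
d-sym θ x̃ ỹ = ≡⇒≈ᴿ (sum-cong-≗ (λ e → dₑ-sym θ (lookup x̃ e) (lookup ỹ e)))

module _ (θ : ℝ) (½≤θ : ½ℝ ≤ᴿ θ) (θ≤1 : θ ≤ᴿ 1ℝ) where

  -- This gap serves twice: two such terms reach 1 in `dₑ-triangle`, and a single one keeps `d` away
  -- from 0 in `d≈0⇒≡`.
  dₑ-discrete : ∀ a b → a ≢ b → ½ℝ ≤ᴿ dₑ θ a b
  dₑ-discrete nothing      nothing      a≢b = contradiction refl a≢b
  dₑ-discrete nothing      (just _)     _   = ½≤θ
  dₑ-discrete (just _)     nothing      _   = ½≤θ
  dₑ-discrete (just true)  (just true)  a≢b = contradiction refl a≢b
  dₑ-discrete (just true)  (just false) _   = ½≤1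
  dₑ-discrete (just false) (just true)  _   = ½≤1
  dₑ-discrete (just false) (just false) a≢b = contradiction refl a≢b

  dₑ≤1 : ∀ a b → dₑ θ a b ≤ᴿ 1ℝ
  dₑ≤1 nothing      nothing      = 0≤1
  dₑ≤1 nothing      (just _)     = θ≤1
  dₑ≤1 (just _)     nothing      = θ≤1
  dₑ≤1 (just true)  (just true)  = 0≤1
  dₑ≤1 (just true)  (just false) = ≤ᴿ-refl 1ℝ
  dₑ≤1 (just false) (just true)  = ≤ᴿ-refl 1ℝ
  dₑ≤1 (just false) (just false) = 0≤1

  _≟ₗ_ : (a b : Maybe Bool) → Dec (a ≡ b)
  _≟ₗ_ = Maybe.≡-dec Bool._≟_

  dₑ-nonNegative : ∀ a b → 0ℝ ≤ᴿ dₑ θ a b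
  dₑ-nonNegative a b with a ≟ₗ b
  ... | yes refl = subst (0ℝ ≤ᴿ_) (sym (dₑ-refl θ a)) (≤ᴿ-refl 0ℝ)
  ... | no a≢b   = ≤ᴿ-trans 0ℝ ½ℝ (dₑ θ a b) 0≤½ (dₑ-discrete a b a≢b)

  dₑ-triangle : ∀ a b c → dₑ θ a c ≤ᴿ dₑ θ a b +ᴿ dₑ θ b c
  dₑ-triangle a b c with a ≟ₗ b | b ≟ₗ c
  -- When `b` equals `a` or `c`, one summand on the right is `dₑ θ a c` itself and the other is
  -- nonnegative.
  ... | yes refl | _        =
    y≤x+y (dₑ θ a a) (dₑ θ a c) (dₑ-nonNegative a a)
  ... | no _     | yes refl =
    x≤x+y (dₑ θ a b) (dₑ θ b b) (dₑ-nonNegative b b)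
  ... | no a≢b   | no b≢c   = ≤ᴿ-trans (dₑ θ a c) 1ℝ (dₑ θ a b +ᴿ dₑ θ b c)
    (dₑ≤1 a c)
    -- The lower bound obtained is `½ℝ +ᴿ ½ℝ`; it is accepted as `1ℝ` because `½ ℚ.+ ½` computes to
    -- `1ℚ`.
    (+ᴿ-mono-≤ᴿ ½ℝ (dₑ θ a b) ½ℝ (dₑ θ b c) (dₑ-discrete a b a≢b) (dₑ-discrete b c b≢c))

  dₑ-nonNegative-at : ∀ {m} (x̃ ỹ : PartialLabelling m) e →
                      0ℝ ≤ᴿ dₑ θ (lookup x̃ e) (lookup ỹ e)
  dₑ-nonNegative-at x̃ ỹ e = dₑ-nonNegative (lookup x̃ e) (lookup ỹ e)

  d-nonNegative : ∀ {m} (x̃ ỹ : PartialLabelling m) → 0ℝ ≤ᴿ d θ x̃ ỹ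
  d-nonNegative x̃ ỹ = sumᴿ-nonNegative _ (dₑ-nonNegative-at x̃ ỹ)

  d-triangle : ∀ {m} (x̃ ỹ z̃ : PartialLabelling m) → d θ x̃ z̃ ≤ᴿ d θ x̃ ỹ +ᴿ d θ ỹ z̃
  d-triangle x̃ ỹ z̃ = begin
    d θ x̃ z̃                     ≤⟨ sumᴿ-mono-≤ _ _ (λ e →
                                     dₑ-triangle (lookup x̃ e) (lookup ỹ e) (lookup z̃ e)) ⟩
    sumᴿ (λ e → xy e +ᴿ yz e)   ≈⟨ ∑-distrib-+ xy yz ⟩
    d θ x̃ ỹ +ᴿ d θ ỹ z̃          ∎
    where
    open ≤-Reasoning ≤ᴿ-poset
    xy = λ e → dₑ θ (lookup x̃ e) (lookup ỹ e)
    yz = λ e → dₑ θ (lookup ỹ e) (lookup z̃ e)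

  -- A coordinate with different labels would alone contribute at least ½ to a sum of nonnegative
  -- terms. Equality of labels is decidable, so refuting a difference is enough.
  d≈0⇒≡ : ∀ {m} (x̃ ỹ : PartialLabelling m) → d θ x̃ ỹ ≈ᴿ 0ℝ → x̃ ≡ ỹ
  d≈0⇒≡ x̃ ỹ d≈0 = Pointwise-≡⇒≡ (ext λ e →
    decidable-stable (lookup x̃ e ≟ₗ lookup ỹ e) λ x̃ₑ≢ỹₑ → ½≰0 (begin
      ½ℝ                               ≤⟨ dₑ-discrete _ _ x̃ₑ≢ỹₑ ⟩
      dₑ θ (lookup x̃ e) (lookup ỹ e)   ≤⟨ term≤sumᴿ _ (dₑ-nonNegative-at x̃ ỹ) e ⟩
      d θ x̃ ỹ                          ≈⟨ d≈0 ⟩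
      0ℝ                               ∎))
    where open ≤-Reasoning ≤ᴿ-poset

-- Closures, and the distance pulled back along them.

module _ {n m} (G′ : Graph n m) (E : Subset m) where

  private
    -- The hinge of the argument: equal classes `X~[_]`, equal closures and distance 0 each turn out
    -- to be equivalent to this relation.
    _≃_ : X~ G′ E → X~ G′ E → Set
    x ≃ y = X[_] G′ E (proj₁ x) ≐ X[_] G′ E (proj₁ y)

    _≈_ : X~ G′ E → X~ G′ E → Set
    _≈_ = _≈~_ G′ E

    clᵖ : X~ G′ E → PartialLabelling m
    clᵖ x = proj₁ (cl G′ E x)

  ≈~⇒≃ : ∀ x y → x ≈ y → x ≃ y
  ≈~⇒≃ (_ , _) (_ , _) refl = ≐-refl

  cl-isMaximum : ∀ x → IsMaximumOf G′ E (X~[_] G′ E x) (cl G′ E x)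
  cl-isMaximum x = proj₁ (proj₂ (closure G′ E x))

  cl≃ : ∀ x → cl G′ E x ≃ x
  cl≃ x = proj₁ (cl-isMaximum x)

  -- The class of `x` depends on `x` only through `X[_]`, so `cl G′ E y` is a maximum of that class
  -- too, and maxima are unique.
  cl-cong : ∀ x y → x ≃ y → cl G′ E x ≈ cl G′ E y
  cl-cong x y x≃y = proj₂ (proj₂ (closure G′ E x)) {cl G′ E y}
    ( ≐-trans (cl≃ y) (≐-sym x≃y)
    , λ z z≃x → proj₂ (cl-isMaximum y) z (≐-trans z≃x x≃y))

  -- A closure lies in the class it is the maximum of, hence determines `X[_]`.
  cl-injective : ∀ x y → cl G′ E x ≈ cl G′ E y → x ≃ y
  cl-injective x y clx≈cly =
    ≐-trans (≐-sym (cl≃ x)) (≐-trans (≈~⇒≃ (cl G′ E x) (cl G′ E y) clx≈cly) (cl≃ y))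

  X~[]-cong : ∀ x y → x ≃ y → X~[_] G′ E x ≐ X~[_] G′ E y
  X~[]-cong x y x≃y = (λ z≃x → ≐-trans z≃x x≃y) , (λ z≃y → ≐-trans z≃y (≐-sym x≃y))

  X~[]-injective : ∀ x y → X~[_] G′ E x ≐ X~[_] G′ E y → x ≃ y
  -- Here `≐-refl` is the membership of `x` in its own class.
  X~[]-injective x y (X~[x]⊆X~[y] , _) = X~[x]⊆X~[y] {x} ≐-refl

  module _ (θ : ℝ) (½≤θ : ½ℝ ≤ᴿ θ) (θ≤1 : θ ≤ᴿ 1ℝ) where

    ≃⇒d~≈0 : ∀ x y → x ≃ y → d~ G′ E θ x y ≈ᴿ 0ℝ
    ≃⇒d~≈0 x y x≃y = subst (λ ỹ → d θ (clᵖ x) ỹ ≈ᴿ 0ℝ)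
      (cl-cong x y x≃y) (d-refl θ (clᵖ x))

    d~≈0⇒cl≈ : ∀ x y → d~ G′ E θ x y ≈ᴿ 0ℝ → cl G′ E x ≈ cl G′ E y
    d~≈0⇒cl≈ x y = d≈0⇒≡ θ ½≤θ θ≤1 (clᵖ x) (clᵖ y)

    d~-isPseudoMetric : IsPseudoMetric _≈_ (d~ G′ E θ)
    d~-isPseudoMetric = record
      { isPreMetric = record
        { isProtoMetric = record
          { isPartialOrder  = ≤ᴿ-isPartialOrder
          ; ≈-isEquivalence = On.isEquivalence proj₁ isEquivalence
          -- Elements related by `_≈_` may carry different witnesses of nonemptiness, so their
          -- closures are compared by `cl-cong`.
          ; cong            = λ {x} {y} {u} {v} x≈y u≈v → ≡⇒≈ᴿ (cong₂ (d θ)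
              (cl-cong x y (≈~⇒≃ x y x≈y)) (cl-cong u v (≈~⇒≃ u v u≈v)))
          ; nonNegative     = λ {x} {y} → d-nonNegative θ ½≤θ θ≤1 (clᵖ x) (clᵖ y)
          }
        ; ≈⇒0 = λ {x} {y} x≈y → ≃⇒d~≈0 x y (≈~⇒≃ x y x≈y)
        }
      ; symmetric = λ x y → d-sym θ (clᵖ x) (clᵖ y)
      ; triangle  = λ x y z → d-triangle θ ½≤θ θ≤1 (clᵖ x) (clᵖ y) (clᵖ z)
      }

    d^-isMetric : IsMetric (_≈^_ G′ E) (d^ G′ E θ)
    d^-isMetric = record
      { isSemiMetric = record
        { isQuasiSemiMetric = record
          { isPreMetric = record
            { isProtoMetric = record
              { isPartialOrder  = isPartialOrder
              ; ≈-isEquivalence = On.isEquivalence proj₁ ≈-isEquivalence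
              ; cong            = λ {x} {y} {u} {v} →
                  d~-cong {proj₁ x} {proj₁ y} {proj₁ u} {proj₁ v}
              ; nonNegative     = λ {x} {y} → nonNegative {proj₁ x} {proj₁ y}
              }
            ; ≈⇒0 = λ {x} {y} → ≈⇒0 {proj₁ x} {proj₁ y}
            }
          -- Separation is the one axiom not inherited from `d~`: closed labellings satisfy
          -- `x ≈ cl x ≈ cl y ≈ y`.
          ; 0⇒≈ = λ { {x , x≈clx} {y , y≈cly} d≈0 →
              trans x≈clx (trans (d~≈0⇒cl≈ x y d≈0) (sym y≈cly)) }
          }
        ; sym = λ (x , _) (y , _) → symmetric x y
        }
      ; triangle = λ (x , _) (y , _) (z , _) → triangle x y z
      }
      where
      open IsPseudoMetric d~-isPseudoMetric
        using (isPartialOrder; ≈-isEquivalence; nonNegative; ≈⇒0; symmetric; triangle)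
        renaming (cong to d~-cong)

theorem6 : ∀ {n m} (G′ : Graph n m) (E : Subset m) → Connected G′ E →
    (θ : ℝ) → ½ℝ ≤ᴿ θ → θ ≤ᴿ 1ℝ →
    IsPseudoMetric (_≈~_ G′ E) (d~ G′ E θ) ×
    IsMetric (_≈^_ G′ E) (d^ G′ E θ) ×
    (∀ (x y : X~ G′ E) →
    X~[_] G′ E x ≐ X~[_] G′ E y ⇔ d~ G′ E θ x y ≈ᴿ 0ℝ)
theorem6 G′ E _ θ ½≤θ θ≤1 =
  d~-isPseudoMetric G′ E θ ½≤θ θ≤1 ,
  d^-isMetric G′ E θ ½≤θ θ≤1 ,
  λ x y → mk⇔
    (λ X~[x]≐X~[y] → ≃⇒d~≈0 G′ E θ ½≤θ θ≤1 x y (X~[]-injective G′ E x y X~[x]≐X~[y]))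
    (λ d~≈0 → X~[]-cong G′ E x y
      (cl-injective G′ E x y (d~≈0⇒cl≈ G′ E θ ½≤θ θ≤1 x y d~≈0)))
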